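{- Let $C$ be the set of rational Cauchy sequences with the relations $\sim$, $<$ and $\lesssim$ defined in the context. Let $B\subset C$ be a nonempty set for which there is some $(a_n)\in C$ such that $(b_n)\lesssim(a_n)$ for every $(b_n)\in B$. Then $B$ has a least upper bound, that is, there exists a sequence $(a_n')\in C$, unique up to $\sim$, such that (i) $(b_n)\lesssim(a_n')$ for every $(b_n)\in B$, and (ii) for every $(c_n)\in C$ with $(c_n)<(a_n')$ there is a $(b_n)\in B$ with $(c_n)<(b_n)$.
   Context: Here $\mathbb{N}=\{1,2,3,\dots\}$, and $k,m,n,n_0$ range over $\mathbb{N}$. A sequence $(a_n)=(a_n)_{n\in\mathbb{N}}$ in $\mathbb{Q}$ is Cauchy if $\forall k\,\exists n_0\,(m,n\ge n_0\Rightarrow |a_m-a_n|\le 1/k)$. Let $C$ be the set of all Cauchy sequences in $\mathbb{Q}$ (no quotient is taken). On $C$ define the equivalence relation $(a_n)\sim(b_n)\iff \forall k\,\exists n_0\,(n\ge n_0\Rightarrow |a_n-b_n|\le 1/k)$ and the relation $(a_n)<(b_n)\iff \exists k\,\exists n_0\,(n\ge n_0\Rightarrow a_n<b_n-1/k)$. The notation $(a_n)\lesssim(b_n)$ means that $(a_n)<(b_n)$ or $(a_n)\sim(b_n)$. "Unique up to $\sim$" means that any two sequences in $C$ satisfying both (i) and (ii) are related by $\sim$. -}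

module Defs where

open import Data.Integer.Base using (+_)
open import Data.Nat.Base as ℕ using (ℕ; NonZero)
open import Data.Product.Base using (∃-syntax; _×_)
open import Data.Rational.Base as ℚ using (ℚ; _/_; _-_; ∣_∣)
open import Data.Sum.Base using (_⊎_)
open import Level using (Level)
open import Relation.Unary using (Pred; _∈_)

private
  variable
    ℓ : Level

record ℕ⁺ : Set where
  constructor mkℕ⁺
  field
    toℕ          : ℕ
    .{{nonZero}} : NonZero toℕ

open ℕ⁺ public using (toℕ)

infix 4 _≥_

_≥_ : ℕ⁺ → ℕ⁺ → Set
m ≥ n = toℕ m ℕ.≥ toℕ n

1/_ : ℕ⁺ → ℚ
1/ (mkℕ⁺ k) = + 1 / k

IsCauchy : (ℕ⁺ → ℚ) → Set
IsCauchy a = ∀ k → ∃[ n₀ ] (∀ m n → m ≥ n₀ → n ≥ n₀ → ∣ a m - a n ∣ ℚ.≤ 1/ k)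

record C : Set where
  constructor mkC
  field
    seq    : ℕ⁺ → ℚ
    cauchy : IsCauchy seq

open C public

infix 4 _∼_ _<_ _≲_

_∼_ : C → C → Set
a ∼ b = ∀ k → ∃[ n₀ ] (∀ n → n ≥ n₀ → ∣ seq a n - seq b n ∣ ℚ.≤ 1/ k)

_<_ : C → C → Set
a < b = ∃[ k ] ∃[ n₀ ] (∀ n → n ≥ n₀ → seq a n ℚ.< seq b n - 1/ k)

_≲_ : C → C → Set
a ≲ b = a < b ⊎ a ∼ b

IsUpperBound : Pred C ℓ → C → Set ℓ
IsUpperBound B a = ∀ b → b ∈ B → b ≲ a

IsLeastUpperBound : Pred C ℓ → C → Set ℓ
IsLeastUpperBound B a =
  IsUpperBound B a × (∀ c → c < a → ∃[ b ] (b ∈ B × c < b))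

{-# OPTIONS --safe #-}
-- Call a rational q exceeded if q < b for some b ∈ B.  Stepping through the multiples of 1/n
-- from an exceeded rational towards a bound of B yields, for each n, an exceeded s n such that
-- s n + 1/n is not exceeded.  An exceeded rational is below every non-exceeded one, hence
-- s m < s n + 1/n for all m and n: the sequence s is Cauchy, and it is the least upper bound.
-- Excluded middle decides which rationals are exceeded and gives trichotomy on C.
module Submission where

open import Defs
open import Axiom.ExcludedMiddle using (ExcludedMiddle)
open import Data.Product.Base using (∃-syntax; _×_)
open import Relation.Unary using (Pred; _∈_)
open import Data.Empty using (⊥-elim)
open import Data.Integer.Base as ℤ using (+_; -[1+_])
import Data.Integer.Properties as ℤ
import Data.Integer.Solver as ℤ-Solver
open import Data.Nat.Base as ℕ using (ℕ; zero; suc; NonZero)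
import Data.Nat.Properties as ℕ
open import Data.Product.Base using (_,_; proj₁; proj₂)
open import Data.Rational.Base as ℚ using (ℚ; 0ℚ; mkℚ; fromℚᵘ; _/_; _+_; _-_; -_; ∣_∣)
import Data.Rational.Properties as ℚ
import Data.Rational.Solver as ℚ-Solver
open import Data.Rational.Unnormalised.Base as ℚᵘ using (mkℚᵘ; *≡*; *≤*)
import Data.Rational.Unnormalised.Properties as ℚᵘ
open import Data.Sum.Base using (_⊎_; inj₁; inj₂; [_,_]′)
open import Function.Base using (_∘_; id)
open import Level using (Level; Lift; lift; lower)
open import Relation.Binary.Definitions using (Transitive)
open import Relation.Binary.PropositionalEquality using (_≡_; refl; sym; trans; cong; subst; module ≡-Reasoning)
open import Relation.Nullary using (¬_; Dec; yes; no)
import Relation.Nullary.Decidable as Dec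

open ℚ-Solver.+-*-Solver using (solve; con; _:=_; _:+_; _:-_; :-_)

private
  variable
    ℓ : Level
    p q x y : ℚ

-- Linear arithmetic over ℚ

-- A linear consequence x < y of hypotheses is checked by adding the hypotheses up to p < q
-- and comparing the two differences with the ring solver.
certify-< : p ℚ.< q → q - p ≡ y - x → x ℚ.< y
certify-< {p} {q} {y} {x} p<q eq = begin-strict
  x            ≡⟨ solve 2 (λ p x → x := p :+ (x :- p)) refl p x ⟩
  p + (x - p)  <⟨ ℚ.+-monoˡ-< (x - p) p<q ⟩
  q + (x - p)  ≡⟨ solve 3 (λ p q x → q :+ (x :- p) := (q :- p) :+ x) refl p q x ⟩
  (q - p) + x  ≡⟨ cong (_+ x) eq ⟩
  (y - x) + x  ≡⟨ solve 2 (λ x y → (y :- x) :+ x := y) refl x y ⟩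
  y            ∎
  where open ℚ.≤-Reasoning

certify-≤ : p ℚ.≤ q → q - p ≡ y - x → x ℚ.≤ y
certify-≤ {p} {q} {y} {x} p≤q eq = begin
  x            ≡⟨ solve 2 (λ p x → x := p :+ (x :- p)) refl p x ⟩
  p + (x - p)  ≤⟨ ℚ.+-monoˡ-≤ (x - p) p≤q ⟩
  q + (x - p)  ≡⟨ solve 3 (λ p q x → q :+ (x :- p) := (q :- p) :+ x) refl p q x ⟩
  (q - p) + x  ≡⟨ cong (_+ x) eq ⟩
  (y - x) + x  ≡⟨ solve 2 (λ x y → (y :- x) :+ x := y) refl x y ⟩
  y            ∎
  where open ℚ.≤-Reasoning

x<y-ε⇒x+ε<y : ∀ x y ε → x ℚ.< y - ε → x + ε ℚ.< y
x<y-ε⇒x+ε<y x y ε h =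
  certify-< h (solve 3 (λ x y ε → (y :- ε) :- x := y :- (x :+ ε)) refl x y ε)

x<y-ε⇒x<y : ∀ x y ε → 0ℚ ℚ.< ε → x ℚ.< y - ε → x ℚ.< y
x<y-ε⇒x<y x y ε 0<ε h = certify-< (ℚ.+-mono-< h 0<ε)
  (solve 3 (λ x y ε → ((y :- ε) :+ ε) :- (x :+ con 0ℚ) := y :- x) refl x y ε)

p≤∣p∣ : ∀ p → p ℚ.≤ ∣ p ∣
p≤∣p∣ p with ℚ.≤-total 0ℚ p
... | inj₁ 0≤p = ℚ.≤-reflexive (sym (ℚ.0≤p⇒∣p∣≡p 0≤p))
... | inj₂ p≤0 = ℚ.≤-trans p≤0 (ℚ.0≤∣p∣ p)

∣x-y∣≤ε⇒x≤y+ε : ∀ x y ε → ∣ x - y ∣ ℚ.≤ ε → x ℚ.≤ y + ε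
∣x-y∣≤ε⇒x≤y+ε x y ε h = certify-≤ (ℚ.≤-trans (p≤∣p∣ (x - y)) h)
  (solve 3 (λ x y ε → ε :- (x :- y) := (y :+ ε) :- x) refl x y ε)

x≤y+ε∧y≤x+ε⇒∣x-y∣≤ε : ∀ x y ε → x ℚ.≤ y + ε → y ℚ.≤ x + ε → ∣ x - y ∣ ℚ.≤ ε
x≤y+ε∧y≤x+ε⇒∣x-y∣≤ε x y ε x≤y+ε y≤x+ε with ℚ.∣p∣≡p∨∣p∣≡-p (x - y)
... | inj₁ eq = subst (ℚ._≤ ε) (sym eq) (certify-≤ x≤y+ε
  (solve 3 (λ x y ε → (y :+ ε) :- x := ε :- (x :- y)) refl x y ε))
... | inj₂ eq = subst (ℚ._≤ ε) (sym eq) (certify-≤ y≤x+ε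
  (solve 3 (λ x y ε → (x :+ ε) :- y := ε :- (:- (x :- y))) refl x y ε))

three-thirds-gap : ∀ x x′ y y′ ε δ → δ + δ + δ ≡ ε → x′ ℚ.≤ x + δ → y ℚ.≤ y′ + δ →
                   x + ε ℚ.< y → x′ ℚ.< y′ - δ
three-thirds-gap x x′ y y′ _ δ refl x′≤x+δ y≤y′+δ gap =
  certify-< (ℚ.+-mono-<-≤ gap (ℚ.+-mono-≤ x′≤x+δ y≤y′+δ))
    (solve 5 (λ x x′ y y′ δ →
        (y :+ ((x :+ δ) :+ (y′ :+ δ))) :- ((x :+ (δ :+ δ :+ δ)) :+ (x′ :+ y)) := (y′ :- δ) :- x′)
      refl x x′ y y′ δ)

limit-gap : ∀ x x′ y ε δ → δ + δ + δ ≡ ε → x ℚ.≤ x′ + δ → x′ ℚ.< y - ε → x + δ ℚ.< y - δ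
limit-gap x x′ y _ δ refl x≤x′+δ gap = certify-< (ℚ.+-mono-<-≤ gap x≤x′+δ)
  (solve 4 (λ x x′ y δ →
      ((y :- (δ :+ δ :+ δ)) :+ (x′ :+ δ)) :- (x′ :+ x) := (y :- δ) :- (x :+ δ))
    refl x x′ y δ)

x<y-ε∧y≤z+ε⇒x<z : ∀ x y z ε → x ℚ.< y - ε → y ℚ.≤ z + ε → x ℚ.< z
x<y-ε∧y≤z+ε⇒x<z x y z ε x<y-ε y≤z+ε = certify-< (ℚ.+-mono-<-≤ x<y-ε y≤z+ε)
  (solve 4 (λ x y z ε → ((y :- ε) :+ (z :+ ε)) :- (x :+ y) := z :- x) refl x y z ε)

-- Unit fractions

-- `_/_` normalises by a gcd and so does not compute on variables; the identity is checked on
-- unnormalised fractions, whose sum keeps the denominator `n * n`.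
i/n+j/n≡[i+j]/n : ∀ i j n .{{_ : NonZero n}} → + i / n + + j / n ≡ + (i ℕ.+ j) / n
i/n+j/n≡[i+j]/n i j (suc d) = ℚ.toℚᵘ-injective (begin
  ℚ.toℚᵘ (fromℚᵘ i/n + fromℚᵘ j/n)              ≈⟨ ℚ.toℚᵘ-homo-+ (fromℚᵘ i/n) (fromℚᵘ j/n) ⟩
  ℚ.toℚᵘ (fromℚᵘ i/n) ℚᵘ.+ ℚ.toℚᵘ (fromℚᵘ j/n)  ≈⟨ ℚᵘ.+-cong (ℚ.toℚᵘ-fromℚᵘ i/n) (ℚ.toℚᵘ-fromℚᵘ j/n) ⟩
  i/n ℚᵘ.+ j/n                                  ≈⟨ *≡* cross ⟩
  mkℚᵘ (+ (i ℕ.+ j)) d                          ≈⟨ ℚ.toℚᵘ-fromℚᵘ (mkℚᵘ (+ (i ℕ.+ j)) d) ⟨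
  ℚ.toℚᵘ (fromℚᵘ (mkℚᵘ (+ (i ℕ.+ j)) d))        ∎)
  where
  open ℚᵘ.≃-Reasoning
  i/n = mkℚᵘ (+ i) d
  j/n = mkℚᵘ (+ j) d
  n = + suc d
  open ℤ-Solver.+-*-Solver renaming (solve to ℤ-solve; _:=_ to _⊜_; _:+_ to _⊕_; _:*_ to _⊛_)
  cross : (+ i ℤ.* n ℤ.+ + j ℤ.* n) ℤ.* n ≡ + (i ℕ.+ j) ℤ.* (n ℤ.* n)
  cross = trans
    (ℤ-solve 3 (λ i j n → (i ⊛ n ⊕ j ⊛ n) ⊛ n ⊜ (i ⊕ j) ⊛ (n ⊛ n)) refl (+ i) (+ j) n)
    (cong (ℤ._* (n ℤ.* n)) (sym (ℤ.pos-+ i j)))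

third : ℕ⁺ → ℕ⁺
third (mkℕ⁺ k) = mkℕ⁺ (3 ℕ.* k) {{ℕ.m*n≢0 3 k}}

1/third+1/third+1/third≡1/k : ∀ k → 1/ third k + 1/ third k + 1/ third k ≡ 1/ k
1/third+1/third+1/third≡1/k (mkℕ⁺ (suc d)) = begin
  + 1 / 3k + + 1 / 3k + + 1 / 3k  ≡⟨ cong (_+ + 1 / 3k) (i/n+j/n≡[i+j]/n 1 1 3k) ⟩
  + 2 / 3k + + 1 / 3k             ≡⟨ i/n+j/n≡[i+j]/n 2 1 3k ⟩
  + 3 / 3k                        ≡⟨ ℚ.fromℚᵘ-cong 3/3k≃1/k ⟩
  + 1 / suc d                     ∎
  where
  open ≡-Reasoning
  3k = 3 ℕ.* suc d
  -- `mkℚᵘ` stores the denominator minus one, so its second argument is the predecessor of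
  -- `3 * suc d`, unfolded.
  3/3k≃1/k : mkℚᵘ (+ 3) (d ℕ.+ (suc d ℕ.+ (suc d ℕ.+ 0))) ℚᵘ.≃ mkℚᵘ (+ 1) d
  3/3k≃1/k = *≡* (cong +_ (sym (ℕ.*-identityˡ 3k)))

1/-antitone : ∀ {m n} → m ≥ n → 1/ m ℚ.≤ 1/ n
1/-antitone {mkℕ⁺ (suc m)} {mkℕ⁺ (suc n)} n≤m = ℚ.toℚᵘ-cancel-≤ (begin
  ℚ.toℚᵘ (fromℚᵘ (mkℚᵘ (+ 1) m))  ≃⟨ ℚ.toℚᵘ-fromℚᵘ (mkℚᵘ (+ 1) m) ⟩
  mkℚᵘ (+ 1) m                    ≤⟨ *≤* (ℤ.*-monoˡ-≤-nonNeg (+ 1) (ℤ.+≤+ n≤m)) ⟩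
  mkℚᵘ (+ 1) n                    ≃⟨ ℚ.toℚᵘ-fromℚᵘ (mkℚᵘ (+ 1) n) ⟨
  ℚ.toℚᵘ (fromℚᵘ (mkℚᵘ (+ 1) n))  ∎)
  where open ℚᵘ.≤-Reasoning

1/-positive : ∀ k → 0ℚ ℚ.< 1/ k
1/-positive (mkℕ⁺ k) = ℚ.positive⁻¹ (+ 1 / k) {{ℚ.normalize-pos 1 k}}

i≤∣i∣ : ∀ i → i ℤ.≤ + ℤ.∣ i ∣
i≤∣i∣ (+ _)    = ℤ.≤-refl
i≤∣i∣ -[1+ _ ] = ℤ.-≤+

archimedean : ∀ p n .{{_ : NonZero n}} → ∃[ i ] p ℚ.≤ + i / n
archimedean (mkℚ z d _) (suc n) = ℤ.∣ z ∣ ℕ.* suc n , ℚ.toℚᵘ-cancel-≤ (begin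
  mkℚᵘ z d                        ≤⟨ *≤* cross ⟩
  mkℚᵘ (+ i) n                    ≃⟨ ℚ.toℚᵘ-fromℚᵘ (mkℚᵘ (+ i) n) ⟨
  ℚ.toℚᵘ (fromℚᵘ (mkℚᵘ (+ i) n))  ∎)
  where
  -- With this numerator `+ i / suc n` has the value of the integer |z|, which dominates z / (d +
  -- 1).
  i = ℤ.∣ z ∣ ℕ.* suc n
  cross : z ℤ.* + suc n ℤ.≤ + i ℤ.* + suc d
  cross = begin
    z ℤ.* + suc n            ≤⟨ ℤ.*-monoʳ-≤-nonNeg (+ suc n) (i≤∣i∣ z) ⟩
    + ℤ.∣ z ∣ ℤ.* + suc n    ≡⟨ ℤ.pos-* ℤ.∣ z ∣ (suc n) ⟨
    + i                      ≤⟨ ℤ.+≤+ (ℕ.m≤m*n i (suc d)) ⟩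
    + (i ℕ.* suc d)          ≡⟨ ℤ.pos-* i (suc d) ⟩
    + i ℤ.* + suc d          ∎
    where open ℤ.≤-Reasoning
  open ℚᵘ.≤-Reasoning

≥-directed : ∀ m n → ∃[ o ] (o ≥ m × o ≥ n)
≥-directed m n with ℕ.≤-total (toℕ m) (toℕ n)
... | inj₁ m≤n = n , m≤n , ℕ.≤-refl
... | inj₂ n≤m = m , ℕ.≤-refl , n≤m

1⁺ : ℕ⁺
1⁺ = mkℕ⁺ 1

-- The order on Cauchy sequences

<-trans : Transitive _<_
<-trans {a} {b} {c} (k , n₁ , a<b) (l , n₂ , b<c) =
  let n₀ , n₀≥n₁ , n₀≥n₂ = ≥-directed n₁ n₂
  in k , n₀ , λ n n≥n₀ →
  ℚ.<-trans
    (a<b n (ℕ.≤-trans n₀≥n₁ n≥n₀))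
    (ℚ.+-monoˡ-< (- (1/ k))
      (x<y-ε⇒x<y (seq b n) (seq c n) (1/ l) (1/-positive l) (b<c n (ℕ.≤-trans n₀≥n₂ n≥n₀))))

<-irrefl : ∀ {a} → ¬ a < a
<-irrefl {a} (k , n₀ , a<a) = ℚ.<-irrefl {seq a n₀} refl
  (x<y-ε⇒x<y (seq a n₀) (seq a n₀) (1/ k) (1/-positive k) (a<a n₀ ℕ.≤-refl))

<⇒≁ : ∀ {a b} → a < b → ¬ b ∼ a
<⇒≁ {a} {b} (k , n₁ , a<b) b∼a =
  -- Closeness is requested at the very `k` of the gap: at a late common index, `seq b n` is both
  -- above and at most `seq a n + 1/ k`.
  let n₂ , close = b∼a k
      n , n≥n₁ , n≥n₂ = ≥-directed n₁ n₂
  in ℚ.<-irrefl {seq a n + 1/ k} refl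
    (ℚ.<-≤-trans
      (x<y-ε⇒x+ε<y (seq a n) (seq b n) (1/ k) (a<b n n≥n₁))
      (∣x-y∣≤ε⇒x≤y+ε (seq b n) (seq a n) (1/ k) (close n n≥n₂)))

<⇒≴ : ∀ {a b} → a < b → ¬ b ≲ a
<⇒≴ {a} {b} a<b (inj₁ b<a) = <-irrefl {a} (<-trans {a} {b} {a} a<b b<a)
<⇒≴ {a} {b} a<b (inj₂ b∼a) = <⇒≁ {a} {b} a<b b∼a

-- The gap 1/k splits into three thirds: one for each oscillation, one for the witness of a < b.
gap⇒< : ∀ a b k → ∃[ n₀ ] (∀ n → n ≥ n₀ → seq a n + 1/ k ℚ.< seq b n → a < b)
gap⇒< a b k =
  let n₁ , a-close = cauchy a (third k)
      n₂ , b-close = cauchy b (third k)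
      n₀ , n₀≥n₁ , n₀≥n₂ = ≥-directed n₁ n₂
  in n₀ , λ n n≥n₀ gap → third k , n₀ , λ m m≥n₀ →
  three-thirds-gap (seq a n) (seq a m) (seq b n) (seq b m) (1/ k) (1/ third k)
    (1/third+1/third+1/third≡1/k k)
    (∣x-y∣≤ε⇒x≤y+ε (seq a m) (seq a n) (1/ third k)
      (a-close m n (ℕ.≤-trans n₀≥n₁ m≥n₀) (ℕ.≤-trans n₀≥n₁ n≥n₀)))
    (∣x-y∣≤ε⇒x≤y+ε (seq b n) (seq b m) (1/ third k)
      (b-close n m (ℕ.≤-trans n₀≥n₂ n≥n₀) (ℕ.≤-trans n₀≥n₂ m≥n₀)))
    gap

-- By `gap⇒<`, a gap of more than 1/k at a single late index would already give a strict inequality,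
-- so at late indices neither sequence exceeds the other by more than 1/k.
≮∧≯⇒∼ : ∀ {a b} → ¬ a < b → ¬ b < a → a ∼ b
≮∧≯⇒∼ {a} {b} a≮b b≮a k =
  let n₁ , gap₁ = gap⇒< a b k
      n₂ , gap₂ = gap⇒< b a k
      n₀ , n₀≥n₁ , n₀≥n₂ = ≥-directed n₁ n₂
  in n₀ , λ n n≥n₀ →
  x≤y+ε∧y≤x+ε⇒∣x-y∣≤ε (seq a n) (seq b n) (1/ k)
    (ℚ.≮⇒≥ λ gap → b≮a (gap₂ n (ℕ.≤-trans n₀≥n₂ n≥n₀) gap))
    (ℚ.≮⇒≥ λ gap → a≮b (gap₁ n (ℕ.≤-trans n₀≥n₁ n≥n₀) gap))

-- Rational bounds of a Cauchy sequence

const : ℚ → C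
const q = mkC (λ _ → q) λ k → 1⁺ , λ _ _ _ _ →
  subst (ℚ._≤ 1/ k) (cong ∣_∣ (sym (ℚ.+-inverseʳ q))) (ℚ.<⇒≤ (1/-positive k))

const-mono-≤-< : ∀ {b} → p ℚ.≤ q → const q < b → const p < b
const-mono-≤-< p≤q (k , n₀ , q<b) = k , n₀ , λ n n≥n₀ → ℚ.≤-<-trans p≤q (q<b n n≥n₀)

x-3ε<y-ε : ∀ x y ε → 0ℚ ℚ.< ε → x ℚ.≤ y + ε → x - (ε + ε + ε) ℚ.< y - ε
x-3ε<y-ε x y ε 0<ε x≤y+ε = certify-< (ℚ.+-mono-<-≤ 0<ε x≤y+ε)
  (solve 3 (λ x y ε → (ε :+ (y :+ ε)) :- (con 0ℚ :+ x) := (y :- ε) :- (x :- (ε :+ ε :+ ε)))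
    refl x y ε)

x<y+3ε-ε : ∀ x y ε → 0ℚ ℚ.< ε → x ℚ.≤ y + ε → x ℚ.< (y + (ε + ε + ε)) - ε
x<y+3ε-ε x y ε 0<ε x≤y+ε = certify-< (ℚ.+-mono-<-≤ 0<ε x≤y+ε)
  (solve 3 (λ x y ε → (ε :+ (y :+ ε)) :- (con 0ℚ :+ x) := ((y :+ (ε :+ ε :+ ε)) :- ε) :- x)
    refl x y ε)

rational-below : ∀ a → ∃[ q ] const q < a
rational-below a =
  let n₀ , close = cauchy a 1⁺
  -- Of the three units subtracted, one covers the oscillation of `a`, one is the gap that witnesses
  -- `_<_`, and one makes the inequality strict.
  in seq a n₀ - (1/ 1⁺ + 1/ 1⁺ + 1/ 1⁺) , 1⁺ , n₀ , λ n n≥n₀ →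
  x-3ε<y-ε (seq a n₀) (seq a n) (1/ 1⁺) (1/-positive 1⁺)
    (∣x-y∣≤ε⇒x≤y+ε (seq a n₀) (seq a n) (1/ 1⁺) (close n₀ n ℕ.≤-refl n≥n₀))

rational-above : ∀ a → ∃[ q ] a < const q
rational-above a =
  let n₀ , close = cauchy a 1⁺
  in seq a n₀ + (1/ 1⁺ + 1/ 1⁺ + 1/ 1⁺) , 1⁺ , n₀ , λ n n≥n₀ →
  x<y+3ε-ε (seq a n) (seq a n₀) (1/ 1⁺) (1/-positive 1⁺)
    (∣x-y∣≤ε⇒x≤y+ε (seq a n) (seq a n₀) (1/ 1⁺) (close n n₀ n≥n₀ ℕ.≤-refl))

-- Search downwards from a failing index: the first success met has a failure just above it, and
-- `P 0` stops the search.
switch-point : {P : ℕ → Set ℓ} → (∀ i → Dec (P i)) → P 0 → ∀ n → ¬ P n → ∃[ i ] (P i × ¬ P (suc i))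
switch-point P? P0 zero    ¬Pn = ⊥-elim (¬Pn P0)
switch-point P? P0 (suc n) ¬Pn with P? n
... | yes Pn  = n , Pn , ¬Pn
... | no  ¬Pn = switch-point P? P0 n ¬Pn

-- Existence and uniqueness of the supremum

module Supremum (em : ExcludedMiddle ℓ) (B : Pred C ℓ) where

  -- Excluded middle is given at level `ℓ`, whereas `_<_` lives in `Set`; lifting bridges the two.
  decide : (P : Set) → Dec P
  decide P = Dec.map′ lower lift (em {Lift ℓ P})

  ≲-or-> : ∀ a b → a ≲ b ⊎ b < a
  ≲-or-> a b with decide (a < b) | decide (b < a)
  ... | yes a<b | _       = inj₁ (inj₁ a<b)
  ... | no  _   | yes b<a = inj₂ b<a
  ... | no  a≮b | no  b≮a = inj₁ (inj₂ (≮∧≯⇒∼ {a} {b} a≮b b≮a))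

  -- This is the open lower Dedekind cut of the supremum to be constructed.
  Exceeded : Pred ℚ ℓ
  Exceeded q = ∃[ b ] (b ∈ B × const q < b)

  exceeded-antitone : p ℚ.≤ q → Exceeded q → Exceeded p
  exceeded-antitone p≤q (b , b∈B , q<b) = b , b∈B , const-mono-≤-< {b = b} p≤q q<b

  exceeded<unexceeded : Exceeded p → ¬ Exceeded q → p ℚ.< q
  exceeded<unexceeded p∈ q∉ = ℚ.≰⇒> λ q≤p → q∉ (exceeded-antitone q≤p p∈)

  approximation : ∃[ q ] Exceeded q → ∃[ q ] (¬ Exceeded q) → ∀ n → ∃[ s ] (Exceeded s × ¬ Exceeded (s + 1/ n))
  approximation (lo , lo∈) (hi , hi∉) (mkℕ⁺ n) with archimedean (hi - lo) n
  ... | N , hi-lo≤N/n = found (switch-point (λ _ → em) start N end)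
    where
    grid : ℕ → ℚ
    grid i = lo + + i / n
    start : Exceeded (grid 0)
    start = exceeded-antitone (ℚ.≤-reflexive (trans (cong (λ e → lo + e) (ℚ.0/n≡0 n)) (ℚ.+-identityʳ lo))) lo∈
    -- The choice of `N` puts `grid N` at or beyond `hi`, so exceeding it would mean exceeding `hi`.
    end : ¬ Exceeded (grid N)
    end = hi∉ ∘ exceeded-antitone (certify-≤ hi-lo≤N/n
      (solve 3 (λ lo hi e → e :- (hi :- lo) := (lo :+ e) :- hi) refl lo hi (+ N / n)))
    grid-suc : ∀ i → grid (suc i) ≡ grid i + + 1 / n
    grid-suc i = trans
      (cong (λ e → lo + e) (trans (cong (λ j → + j / n) (ℕ.+-comm 1 i)) (sym (i/n+j/n≡[i+j]/n i 1 n))))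
      (sym (ℚ.+-assoc lo (+ i / n) (+ 1 / n)))
    found : ∃[ i ] (Exceeded (grid i) × ¬ Exceeded (grid (suc i))) →
            ∃[ s ] (Exceeded s × ¬ Exceeded (s + + 1 / n))
    found (i , i∈ , i+1∉) = grid i , i∈ , i+1∉ ∘ subst Exceeded (sym (grid-suc i))

  module Limit (s : ℕ⁺ → ℚ) (s∈ : ∀ n → Exceeded (s n)) (s∉ : ∀ n → ¬ Exceeded (s n + 1/ n)) where

    -- The one-sided form leaves `m` free. Swapping `m` and `n` gives the Cauchy property, and a
    -- fixed term can be compared with all late ones.
    s-close : ∀ m n k → n ≥ k → s m ℚ.≤ s n + 1/ k
    s-close m n k n≥k = ℚ.≤-trans
      (ℚ.<⇒≤ (exceeded<unexceeded (s∈ m) (s∉ n)))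
      (ℚ.+-monoʳ-≤ (s n) (1/-antitone {n} {k} n≥k))

    limit : C
    limit = mkC s λ k → k , λ m n m≥k n≥k →
      x≤y+ε∧y≤x+ε⇒∣x-y∣≤ε (s m) (s n) (1/ k) (s-close m n k n≥k) (s-close n m k m≥k)

    -- A gap 1/k below `b` would make `b` exceed `s (third k) + 1/ third k`. One third pays for
    -- passing from `s n` to `s (third k)`, one for the added fraction, and one remains as the new
    -- gap.
    limit-not-below : ∀ b → b ∈ B → ¬ limit < b
    limit-not-below b b∈B (k , n₀ , s<b) = s∉ (third k) (b , b∈B , third k , n₁ , bound)
      where
      directed = ≥-directed n₀ (third k)
      n₁ = proj₁ directed
      bound : ∀ n → n ≥ n₁ → s (third k) + 1/ third k ℚ.< seq b n - 1/ third k
      bound n n≥n₁ = limit-gap (s (third k)) (s n) (seq b n) (1/ k) (1/ third k)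
        (1/third+1/third+1/third≡1/k k)
        (s-close (third k) n (third k) (ℕ.≤-trans (proj₂ (proj₂ directed)) n≥n₁))
        (s<b n (ℕ.≤-trans (proj₁ (proj₂ directed)) n≥n₁))

    limit-approached : ∀ c → c < limit → ∃[ b ] (b ∈ B × c < b)
    limit-approached c (k , n₁ , c<s) =
      -- The gap 1/k selects the term `s k`: every `s n - 1/ k` is at most `s k`, so a member of `B`
      -- exceeding `s k` also lies above `c`.
      let b , b∈B , l , n₂ , sk<b = s∈ k
          n₀ , n₀≥n₁ , n₀≥n₂ = ≥-directed n₁ n₂
      in b , b∈B , l , n₀ , λ n n≥n₀ →
      ℚ.<-trans
        (x<y-ε∧y≤z+ε⇒x<z (seq c n) (s n) (s k) (1/ k)
          (c<s n (ℕ.≤-trans n₀≥n₁ n≥n₀)) (s-close n k k ℕ.≤-refl))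
        (sk<b n (ℕ.≤-trans n₀≥n₂ n≥n₀))

    limit-isLUB : IsLeastUpperBound B limit
    limit-isLUB =
      (λ b b∈B → [ id , ⊥-elim ∘ limit-not-below b b∈B ]′ (≲-or-> b limit)) ,
      limit-approached

  supremum : ∃[ b ] (b ∈ B) → ∃[ a ] IsUpperBound B a → ∃[ a′ ] IsLeastUpperBound B a′
  supremum (b , b∈B) (a , a-ub) = limit , limit-isLUB
    where
    above = rational-above a
    approx = approximation
      (proj₁ (rational-below b) , b , b∈B , proj₂ (rational-below b))
      -- A member `c` exceeding a rational above `a` would satisfy `a < c`, contradicting `c ≲ a`.
      (proj₁ above , λ (c , c∈B , hi<c) →
        <⇒≴ {a} {c} (<-trans {a} {const (proj₁ above)} {c} (proj₂ above) hi<c) (a-ub c c∈B))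
    open Limit (proj₁ ∘ approx) (proj₁ ∘ proj₂ ∘ approx) (proj₂ ∘ proj₂ ∘ approx)

  -- If `x < y`, leastness of `y` yields a member of `B` above `x`, which `x` as an upper bound
  -- forbids. Used in both directions, this gives uniqueness.
  bound-not-below-lub : ∀ {x y} → IsUpperBound B x → IsLeastUpperBound B y → ¬ x < y
  bound-not-below-lub {x} x-ub (_ , y-least) x<y with y-least x x<y
  ... | b , b∈B , x<b = <⇒≴ {x} {b} x<b (x-ub b b∈B)

  lub-unique : ∀ x y → IsLeastUpperBound B x → IsLeastUpperBound B y → x ∼ y
  lub-unique x y x-lub y-lub = ≮∧≯⇒∼ {x} {y}
    (bound-not-below-lub {x} {y} (proj₁ x-lub) y-lub)
    (bound-not-below-lub {y} {x} (proj₁ y-lub) x-lub)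

theorem3p5 : ∀ {ℓ} → ExcludedMiddle ℓ →
    (B : Pred C ℓ) →
    (∃[ b ] (b ∈ B)) →
    (∃[ a ] (IsUpperBound B a)) →
    (∃[ a′ ] (IsLeastUpperBound B a′)) ×
    (∀ x y → IsLeastUpperBound B x → IsLeastUpperBound B y → x ∼ y)
theorem3p5 em B nonempty bounded = supremum nonempty bounded , lub-unique
  where open Supremum em B
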